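{- Let $G=(V,E,c)$ be an undirected weighted graph. Let $K$ denote a set of pairwise non-crossing minimum separating cuts in $G$, and let $F$ denote a set of associated cut pairs, i.e. $F$ consists of one cut pair for each cut in $K$ (distinct cuts being associated with distinct pairs), such that each cut in $K$ separates exactly one pair in $F$ (namely its associated cut pair). Then there exists a valid intermediate cut tree of $G$ representing exactly the cuts in $K$.
   Context: $G=(V,E,c)$ is a finite undirected graph with positive edge costs $c$. A cut is a partition of $V$ into two nonempty cut sides $S$ and $V\setminus S$; its cost $c(S,V\setminus S)$ is the sum of the costs of all edges with one endpoint in each side. Two cuts are non-crossing if their cut sides are pairwise nested or disjoint (i.e. some side of the one cut is contained in some side of the other). A cut separates two vertices $u,v$ if they lie on different cut sides. A minimum $u$-$v$-cut is a cut of minimum cost among all cuts separating $u$ and $v$. A cut is a minimum separating cut if there exists a vertex pair $\{u,v\}$ for which it is a minimum $u$-$v$-cut; any such $\{u,v\}$ is called a cut pair of the cut. An intermediate cut tree of $G$ is a weighted tree $T_*=(V_*,E_*,c_*)$ whose nodes are nonempty sets of vertices forming a partition of $V$. Each edge $\{S,S'\}\in E_*$ induces (represents) the cut of $G$ whose two sides are the unions of the nodes in the two connected components obtained by deleting $\{S,S'\}$ from $T_*$, and $c_*(\{S,S'\})$ is the cost of this cut. Each edge represents a minimum separating cut. The tree $T_*$ is valid if for every edge $\{S,S'\}\in E_*$ the induced cut has a cut pair $\{x,y\}$ with $x\in S$ and $y\in S'$. The tree represents exactly the cuts in $K$ if the set of cuts induced by its edges is $K$. -}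

module Defs where

open import Algebra.Bundles using (AbelianGroup)
import Algebra.Definitions.RawMonoid as RawMonoidDefinitions
open import Data.Bool.Base using (if_then_else_; _∧_; _xor_)
open import Data.Fin.Base using (Fin)
open import Data.Fin.Properties using (_<?_)
open import Data.Fin.Subset using (Subset; _∈_; _∉_; _⊆_; ∁; Nonempty)
open import Data.List.Base using (List; _∷_; _∷ʳ_)
open import Data.List.Relation.Unary.Linked using (Linked)
open import Data.List.Relation.Unary.Unique.Propositional using (Unique)
open import Data.Nat.Base using (ℕ)
open import Data.Product.Base using (∃; ∃₂; ∃-syntax; _×_; _,_)
open import Data.Product using (∃!)
open import Data.Sum.Base using (_⊎_)
open import Data.Vec.Base using (lookup)
open import Function.Bundles using (_⇔_)
open import Level using (Level; _⊔_; 0ℓ) renaming (suc to lsuc)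
open import Relation.Binary.Construct.Closure.ReflexiveTransitive using (Star)
open import Relation.Binary.Core using (Rel)
open import Relation.Binary.Definitions using (Decidable; Irreflexive; Symmetric)
open import Relation.Binary.PropositionalEquality.Core using (_≡_)
open import Relation.Binary.Structures using (IsTotalOrder)
open import Relation.Nullary.Decidable.Core using (yes; no; does)
open import Relation.Nullary.Negation.Core using (¬_)
open import Relation.Unary using (Pred)

private
  variable
    c ℓ₁ ℓ₂ : Level

-- Costs are taken in an arbitrary totally ordered abelian group; the real
-- numbers are the usual instance.
record OrderedAbelianGroup (c ℓ₁ ℓ₂ : Level) : Set (lsuc (c ⊔ ℓ₁ ⊔ ℓ₂)) where
  infix 4 _≤_
  field
    abelianGroup : AbelianGroup c ℓ₁
  open AbelianGroup abelianGroup public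
    renaming (_∙_ to _+_; ε to 0#; _⁻¹ to -_; ∙-cong to +-cong)
  field
    _≤_          : Rel Carrier ℓ₂
    isTotalOrder : IsTotalOrder _≈_ _≤_
    +-monoˡ-≤    : ∀ {x y} z → x ≤ y → x + z ≤ y + z

  Positive : Pred Carrier (ℓ₁ ⊔ ℓ₂)
  Positive x = 0# ≤ x × ¬ (x ≈ 0#)

  open RawMonoidDefinitions rawMonoid public using (sum)

-- A pair (u , v) stands for the unordered pair {u , v}.
Pair : ℕ → Set
Pair n = Fin n × Fin n

SamePair : ∀ {n} → Rel (Pair n) 0ℓ
SamePair (u , v) (x , y) = (u ≡ x × v ≡ y) ⊎ (u ≡ y × v ≡ x)

record SimpleGraph (n : ℕ) : Set₁ where
  infix 4 _~_ _~?_
  field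
    _~_      : Rel (Fin n) 0ℓ
    _~?_     : Decidable _~_
    ~-sym    : Symmetric _~_
    ~-irrefl : Irreflexive _≡_ _~_

  Connected : Set
  Connected = ∀ u v → Star _~_ u v

  Cycle : List (Fin n) → Set
  Cycle vs = ∃₂ λ x y → ∃₂ λ z zs →
    vs ≡ x ∷ y ∷ z ∷ zs × Unique vs × Linked _~_ (vs ∷ʳ x)

  IsTree : Set
  IsTree = Connected × ¬ ∃ Cycle

  -- Reachability after deletion of the edge {a , b}.
  Without : Pair n → Rel (Fin n) 0ℓ
  Without ab = Star (λ s t → s ~ t × ¬ SamePair (s , t) ab)

record WeightedGraph (C : OrderedAbelianGroup c ℓ₁ ℓ₂) (n : ℕ)
       : Set (lsuc 0ℓ ⊔ c ⊔ ℓ₁) where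
  open OrderedAbelianGroup C using (Carrier; _≈_)
  field
    graph : SimpleGraph n
  open SimpleGraph graph public
  field
    weight     : ∀ {u v} → u ~ v → Carrier
    -- Also forces the weight to be independent of the adjacency proof.
    weight-sym : ∀ {u v} (e : u ~ v) (e′ : v ~ u) → weight e ≈ weight e′

PositiveWeights : {C : OrderedAbelianGroup c ℓ₁ ℓ₂} {n : ℕ} →
                  WeightedGraph C n → Set (ℓ₁ ⊔ ℓ₂)
PositiveWeights {C = C} G = ∀ {u v} (e : u ~ v) → Positive (weight e)
  where open OrderedAbelianGroup C using (Positive)
        open WeightedGraph G

-- A cut is stored through one of its two sides; `_≈ᶜ_` identifies the two
-- ways of storing the same cut.
record Cut (n : ℕ) : Set where
  field
    side          : Subset n
    side-nonempty : Nonempty side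
    ∁-nonempty    : Nonempty (∁ side)

open Cut public

IsSide : ∀ {n} → Cut n → Subset n → Set
IsSide A X = X ≡ side A ⊎ X ≡ ∁ (side A)

infix 4 _≈ᶜ_
_≈ᶜ_ : ∀ {n} → Rel (Cut n) 0ℓ
A ≈ᶜ B = IsSide B (side A)

NonCrossing : ∀ {n} → Rel (Cut n) 0ℓ
NonCrossing A B = ∃₂ λ X Y → IsSide A X × IsSide B Y × X ⊆ Y

Separates : ∀ {n} → Cut n → Pair n → Set
Separates A (u , v) = (u ∈ side A × v ∉ side A) ⊎ (v ∈ side A × u ∉ side A)

module _ {C : OrderedAbelianGroup c ℓ₁ ℓ₂} {n : ℕ} (G : WeightedGraph C n) where
  open OrderedAbelianGroup C using (Carrier; _≤_; 0#; sum)
  open WeightedGraph G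

  weightOr0 : Fin n → Fin n → Carrier
  weightOr0 u v with u ~? v
  ... | yes e = weight e
  ... | no  _ = 0#

  -- Each edge {u , v} is counted once, at u < v.
  cost : Cut n → Carrier
  cost A = sum λ u → sum λ v →
    if does (u <? v) ∧ (lookup (side A) u xor lookup (side A) v)
    then weightOr0 u v else 0#

  IsCutPair : Cut n → Pair n → Set ℓ₂
  IsCutPair A uv = Separates A uv × (∀ B → Separates B uv → cost A ≤ cost B)

  IsMinSeparating : Cut n → Set ℓ₂
  IsMinSeparating A = ∃[ uv ] IsCutPair A uv

  record IntermediateCutTree : Set (lsuc 0ℓ ⊔ c ⊔ ℓ₁ ⊔ ℓ₂) where
    open OrderedAbelianGroup C using (_≈_)
    field
      size : ℕ
      tree : WeightedGraph C size
    open WeightedGraph tree public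
      using () renaming (_~_ to _~ᵀ_; weight to weightᵀ; graph to graphᵀ)
    open SimpleGraph graphᵀ public
      using () renaming (IsTree to IsTreeᵀ; Without to Withoutᵀ)
    field
      isTree         : IsTreeᵀ
      node           : Fin size → Subset n
      node-nonempty  : ∀ s → Nonempty (node s)
      node-partition : ∀ v → ∃! _≡_ λ s → v ∈ node s

    IsUnion : Subset n → Pred (Fin size) 0ℓ → Set
    IsUnion X P = ∀ v → v ∈ X ⇔ (∃[ s ] P s × v ∈ node s)

    -- After deletion of the tree edge {a , b} the two components are those
    -- of a and of b.
    Induces : Pair size → Cut n → Set
    Induces (a , b) A = ∃[ X ] IsSide A X
      × IsUnion X     (Withoutᵀ (a , b) a)
      × IsUnion (∁ X) (Withoutᵀ (a , b) b)

    -- `Induces` determines `cut e` up to `_≈ᶜ_`.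
    field
      cut            : ∀ {a b} → a ~ᵀ b → Cut n
      cut-induced    : ∀ {a b} (e : a ~ᵀ b) → Induces (a , b) (cut e)
      weight-cost    : ∀ {a b} (e : a ~ᵀ b) → weightᵀ e ≈ cost (cut e)
      cut-separating : ∀ {a b} (e : a ~ᵀ b) → IsMinSeparating (cut e)

    Valid : Set ℓ₂
    Valid = ∀ {a b} (e : a ~ᵀ b) →
      ∃₂ λ x y → x ∈ node a × y ∈ node b × IsCutPair (cut e) (x , y)

    RepresentsExactly : ∀ {k} → (Fin k → Cut n) → Set
    RepresentsExactly K =
        (∀ {a b} (e : a ~ᵀ b) → ∃[ i ] cut e ≈ᶜ K i)
      × (∀ i → ∃₂ λ a b → ∃ λ (e : a ~ᵀ b) → cut e ≈ᶜ K i)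

{-# OPTIONS --safe #-}
-- Let two vertices be equivalent if no cut of K separates them, and take the
-- classes as nodes. The pair F i is separated by K i alone, so joining the
-- classes of its two ends for every i gives a graph in which the edge i is the
-- only one to cross K i: every edge is a bridge, and there are no cycles.
-- If K i separates u and v, let p be the end of F i on the side of u. A cut K j
-- with j ≠ i does not separate the two ends of F i, so if it separates u and p
-- then, as it does not cross K i, it separates u and v as well. Induction on the
-- set of separating cuts thus joins u and v by edges that all belong to cuts
-- separating u and v. This gives connectedness, and also that deleting the edge
-- i leaves exactly the two sides of K i.
module Submission where

open import Defs
open import Data.Bool.Base using (Bool; true; false; not)
open import Data.Bool.Properties using (¬-not) renaming (_≟_ to _≟ᵇ_)
open import Data.Empty using (⊥-elim)
open import Data.Fin.Base using (Fin; zero; suc)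
open import Data.Fin.Properties using (any?) renaming (_≟_ to _≟ᶠ_)
open import Data.Fin.Subset using (Subset; _∈_; _∉_; _⊂_; _-_; ∁; ⁅_⁆; ⊤)
open import Data.Fin.Subset.Induction using (⊂-wellFounded)
open import Data.Fin.Subset.Properties
  using (∈⊤; p─q⊆p; x∈p∧x≢y⇒x∈p-y; x∈p⇒p-x⊂p; x∉p⇒x∈∁p; x∈∁p⇒x∉p; x∉⁅y⁆⇒x≢y; x≢y⇒x∉⁅y⁆)
open import Data.List.Base using ([]; _∷_; _∷ʳ_)
open import Data.List.Relation.Unary.All using (All; []; _∷_)
open import Data.List.Relation.Unary.AllPairs using (_∷_)
open import Data.List.Relation.Unary.Linked using (Linked; [-]; _∷_)
open import Data.Nat.Base using (ℕ; zero; suc)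
open import Data.Product using (∃; ∃₂; ∃-syntax; ∃!; _×_; _,_; proj₁; proj₂)
open import Data.Sum.Base using (inj₁; inj₂)
open import Data.Vec.Base using (lookup; tabulate)
open import Data.Vec.Properties
  using (lookup⇒[]=; []=⇒lookup; lookup∘tabulate; tabulate∘lookup; tabulate-cong; ≡-dec)
open import Function.Base using (_∘_)
open import Function.Bundles using (_⇔_; mk⇔; Equivalence)
open import Function.Definitions using (Injective)
open import Induction.WellFounded using (Acc; acc)
open import Level using (Level)
open import Relation.Binary.Construct.Closure.ReflexiveTransitive
  using (Star; ε; _◅_; _◅◅_; map)
open import Relation.Binary.Definitions using (DecidableEquality)
open import Relation.Binary.PropositionalEquality.Core
  using (_≡_; _≢_; refl; sym; trans; cong; subst)
open import Relation.Nullary.Decidable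
  using (Dec; yes; no; does; dec-true; _×-dec_; _⊎-dec_; ¬?; decidable-stable)
open import Relation.Nullary.Negation.Core using (¬_; contradiction)

-- Bits and finite images.

≢-both⇒≡ : ∀ {a b c : Bool} → a ≢ c → b ≢ c → a ≡ b
≢-both⇒≡ a≢c b≢c = trans (¬-not a≢c) (sym (¬-not b≢c))

-- Factorisation of `f` into a surjection and an injection: `π` numbers the classes of equal value,
-- so that they can serve as tree nodes, and `ι` keeps the common value of a class.
record Image {a} {A : Set a} {n : ℕ} (f : Fin n → A) : Set a where
  field
    size        : ℕ
    π           : Fin n → Fin size
    ι           : Fin size → A
    ι-π         : ∀ v → ι (π v) ≡ f v
    π-surj      : ∀ s → ∃[ v ] π v ≡ s
    ι-injective : Injective _≡_ _≡_ ι

image : ∀ {a} {A : Set a} → DecidableEquality A → ∀ {n} (f : Fin n → A) → Image f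
image _≟_ {zero}  f = record
  { size = 0 ; π = λ () ; ι = λ () ; ι-π = λ () ; π-surj = λ ()
  ; ι-injective = λ { {()} } }
image {A = A} _≟_ {suc n} f = extend (any? λ s → ι s ≟ f zero)
  where
  open Image (image _≟_ (f ∘ suc))

  extend : Dec (∃[ s ] ι s ≡ f zero) → Image f
  extend (yes (s₀ , eq)) = record
    { size = size
    ; π = λ { zero → s₀ ; (suc v) → π v }
    ; ι = ι
    ; ι-π = λ { zero → eq ; (suc v) → ι-π v }
    ; π-surj = λ s → let v , e = π-surj s in suc v , e
    ; ι-injective = ι-injective
    }
  extend (no new) = record
    { size = suc size
    ; π = λ { zero → zero ; (suc v) → suc (π v) }
    ; ι = ι′
    ; ι-π = λ { zero → refl ; (suc v) → ι-π v }
    ; π-surj = λ { zero → zero , refl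
                 ; (suc s) → let v , e = π-surj s in suc v , cong suc e }
    ; ι-injective = inj
    }
    where
    ι′ : Fin (suc size) → A
    ι′ zero    = f zero
    ι′ (suc s) = ι s

    inj : Injective _≡_ _≡_ ι′
    inj {zero}  {zero}  _ = refl
    inj {zero}  {suc t} e = ⊥-elim (new (t , sym e))
    inj {suc s} {zero}  e = ⊥-elim (new (s , e))
    inj {suc s} {suc t} e = cong suc (ι-injective e)

-- Subsets as bit vectors, and fibres.

lookup-ext : ∀ {k} {p q : Subset k} → (∀ i → lookup p i ≡ lookup q i) → p ≡ q
lookup-ext {p = p} {q} eq =
  trans (sym (tabulate∘lookup p)) (trans (tabulate-cong eq) (tabulate∘lookup q))

lookup-∉ : ∀ {n} {v : Fin n} {p : Subset n} → v ∉ p → lookup p v ≡ false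
lookup-∉ {v = v} {p} v∉p = ¬-not λ eq → v∉p (lookup⇒[]= v p eq)

∉-lookup : ∀ {n} {v : Fin n} {p : Subset n} → lookup p v ≡ false → v ∉ p
∉-lookup {v = v} eq v∈p with trans (sym eq) ([]=⇒lookup v∈p)
... | ()

fiber : ∀ {n m} → (Fin n → Fin m) → Fin m → Subset n
fiber π s = tabulate λ v → does (π v ≟ᶠ s)

∈-fiber⁺ : ∀ {n m} (π : Fin n → Fin m) {s v} → π v ≡ s → v ∈ fiber π s
∈-fiber⁺ π {v = v} eq =
  lookup⇒[]= v _ (trans (lookup∘tabulate _ v) (dec-true (_ ≟ᶠ _) eq))

∈-fiber⁻ : ∀ {n m} (π : Fin n → Fin m) {s v} → v ∈ fiber π s → π v ≡ s
∈-fiber⁻ π {s} {v} v∈ with trans (sym (lookup∘tabulate _ v)) ([]=⇒lookup v∈)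
... | eq with π v ≟ᶠ s
...   | yes e = e
∈-fiber⁻ _ _ | () | no _

-- Unordered pairs.

SamePair-sym : ∀ {n} {p q : Pair n} → SamePair p q → SamePair q p
SamePair-sym (inj₁ (refl , refl)) = inj₁ (refl , refl)
SamePair-sym (inj₂ (refl , refl)) = inj₂ (refl , refl)

SamePair-trans : ∀ {n} {p q r : Pair n} → SamePair p q → SamePair q r → SamePair p r
SamePair-trans (inj₁ (refl , refl)) e                    = e
SamePair-trans (inj₂ (refl , refl)) (inj₁ (refl , refl)) = inj₂ (refl , refl)
SamePair-trans (inj₂ (refl , refl)) (inj₂ (refl , refl)) = inj₁ (refl , refl)

SamePair-swap : ∀ {n} (a b : Fin n) → SamePair (b , a) (a , b)
SamePair-swap _ _ = inj₂ (refl , refl)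

SamePair-≢ : ∀ {n} {A : Set} (f : Fin n → A) {a b x y : Fin n} →
             SamePair (a , b) (x , y) → f x ≢ f y → f a ≢ f b
SamePair-≢ f (inj₁ (refl , refl)) ne = ne
SamePair-≢ f (inj₂ (refl , refl)) ne = ne ∘ sym

samePair? : ∀ {n} (p q : Pair n) → Dec (SamePair p q)
samePair? (u , v) (x , y) =
  ((u ≟ᶠ x) ×-dec (v ≟ᶠ y)) ⊎-dec ((u ≟ᶠ y) ×-dec (v ≟ᶠ x))

-- Acyclicity from bridges.

module _ {n : ℕ} (H : SimpleGraph n) where
  open SimpleGraph H

  -- The rest of a cycle leads from `y` back to `x` without the edge between them: the vertices of a
  -- cycle are distinct, so every remaining step has an end different from both `x` and `y`.
  bridges⇒acyclic : (∀ {a b} → a ~ b → ¬ Without (a , b) b a) → ¬ ∃ Cycle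
  bridges⇒acyclic bridge
    (_ , x , y , z , zs , refl , (_ ∷ x≢zs) ∷ y≢zs ∷ _ , x~y ∷ y~z ∷ path) =
    bridge x~y ((y~z , first x≢zs y≢zs) ◅ rest z zs x≢zs y≢zs path)
    where
    first : ∀ {z zs} → All (x ≢_) (z ∷ zs) → All (y ≢_) (z ∷ zs) →
            ¬ SamePair (y , z) (x , y)
    first (x≢z ∷ _) (y≢z ∷ _) (inj₁ (_ , z≡y)) = y≢z (sym z≡y)
    first (x≢z ∷ _) _         (inj₂ (_ , z≡x)) = x≢z (sym z≡x)

    rest : ∀ z zs → All (x ≢_) (z ∷ zs) → All (y ≢_) (z ∷ zs) →
           Linked _~_ (z ∷ zs ∷ʳ x) → Without (x , y) z x
    rest z zs (x≢z ∷ x≢zs) (y≢z ∷ y≢zs) path with zs | path | x≢zs | y≢zs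
    ... | []     | z~x ∷ [-]  | _    | _    = (z~x , avoid) ◅ ε
      where
      avoid : ¬ SamePair (z , x) (x , y)
      avoid (inj₁ (z≡x , _)) = x≢z (sym z≡x)
      avoid (inj₂ (z≡y , _)) = y≢z (sym z≡y)
    ... | w ∷ ws | z~w ∷ path′ | x≢ws | y≢ws = (z~w , avoid) ◅ rest w ws x≢ws y≢ws path′
      where
      avoid : ¬ SamePair (z , w) (x , y)
      avoid (inj₁ (z≡x , _)) = x≢z (sym z≡x)
      avoid (inj₂ (z≡y , _)) = y≢z (sym z≡y)

-- Cuts as two-valued functions on the vertices.

module _ {n : ℕ} where

  infix 5 _at_
  _at_ : Cut n → Fin n → Bool
  A at v = lookup (side A) v

  separates⇒≢ : ∀ A {u v} → Separates A (u , v) → A at u ≢ A at v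
  separates⇒≢ _ (inj₁ (u∈ , v∉)) eq = v∉ (lookup⇒[]= _ _ (trans (sym eq) ([]=⇒lookup u∈)))
  separates⇒≢ _ (inj₂ (v∈ , u∉)) eq = u∉ (lookup⇒[]= _ _ (trans eq ([]=⇒lookup v∈)))

  ≢⇒separates : ∀ A {u v} → A at u ≢ A at v → Separates A (u , v)
  ≢⇒separates A {u} {v} ne with A at u in eu | A at v in ev
  ... | true  | false = inj₁ (lookup⇒[]= u _ eu , ∉-lookup ev)
  ... | false | true  = inj₂ (lookup⇒[]= v _ ev , ∉-lookup eu)
  ... | true  | true  = contradiction refl ne
  ... | false | false = contradiction refl ne

  Separates-swap : ∀ (A : Cut n) {u v} → Separates A (u , v) → Separates A (v , u)
  Separates-swap _ (inj₁ s) = inj₂ s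
  Separates-swap _ (inj₂ s) = inj₁ s

  sideOf : Cut n → Bool → Subset n
  sideOf A true  = side A
  sideOf A false = ∁ (side A)

  sideOf-isSide : ∀ A b → IsSide A (sideOf A b)
  sideOf-isSide A true  = inj₁ refl
  sideOf-isSide A false = inj₂ refl

  isSide⇒sideOf : ∀ A {X} → IsSide A X → ∃[ b ] X ≡ sideOf A b
  isSide⇒sideOf _ (inj₁ eq) = true  , eq
  isSide⇒sideOf _ (inj₂ eq) = false , eq

  ∈-sideOf : ∀ A b v → v ∈ sideOf A b ⇔ A at v ≡ b
  ∈-sideOf A true  v = mk⇔ []=⇒lookup (lookup⇒[]= v _)
  ∈-sideOf A false v = mk⇔ (lookup-∉ ∘ x∈∁p⇒x∉p) (x∉p⇒x∈∁p ∘ ∉-lookup)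

  ∈-∁sideOf : ∀ A b v → v ∈ ∁ (sideOf A b) ⇔ A at v ≢ b
  ∈-∁sideOf A b v = mk⇔
    (λ v∈ eq → x∈∁p⇒x∉p v∈ (Equivalence.from (∈-sideOf A b v) eq))
    (λ ne → x∉p⇒x∈∁p (ne ∘ Equivalence.to (∈-sideOf A b v)))

  -- If the side `X` of `A` lies in the side `Y` of `B`, then `X` misses the complement of `Y`.
  empty-quadrant : ∀ A B → NonCrossing A B →
                   ∃₂ λ a b → ∀ v → A at v ≡ a → B at v ≢ b
  empty-quadrant A B (X , Y , isX , isY , X⊆Y)
    with isSide⇒sideOf A isX | isSide⇒sideOf B isY
  ... | a , refl | b , refl = a , not b , λ v eqᵃ eqᵇ →
    not-fixed b (trans (sym (Equivalence.to (∈-sideOf B b v)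
                  (X⊆Y (Equivalence.from (∈-sideOf A a v) eqᵃ)))) eqᵇ)
    where
    not-fixed : ∀ b → b ≢ not b
    not-fixed true  ()
    not-fixed false ()

  -- Otherwise u, p, q, v would occupy all four quadrants.
  separation-propagates : ∀ A B → NonCrossing A B → ∀ {u p q v} →
    A at p ≡ A at u → A at q ≡ A at v → A at u ≢ A at v →
    B at p ≡ B at q → B at u ≢ B at p → B at u ≢ B at v
  separation-propagates A B nc {u} {p} {q} {v} pu qv u≢v pq u≢p uv
    with empty-quadrant A B nc
  ... | a , b , empty with A at u ≟ᵇ a | B at u ≟ᵇ b
  ...   | yes ea | yes eb = empty u ea eb
  ...   | yes ea | no  nb = empty p (trans pu ea) (≢-both⇒≡ (u≢p ∘ sym) (nb ∘ sym))
  ...   | no  na | yes eb = empty v (≢-both⇒≡ (u≢v ∘ sym) (na ∘ sym)) (trans (sym uv) eb)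
  ...   | no  na | no  nb = empty q (trans qv (≢-both⇒≡ (u≢v ∘ sym) (na ∘ sym)))
                              (trans (sym pq) (≢-both⇒≡ (u≢p ∘ sym) (nb ∘ sym)))

-- Nodes and edges of the tree.

module Tree {n k : ℕ} (K : Fin k → Cut n) (F : Fin k → Pair n)
  (noncrossing : ∀ i j → NonCrossing (K i) (K j))
  (sep-self    : ∀ i → Separates (K i) (F i))
  (sep-unique  : ∀ {i j} → Separates (K i) (F j) → i ≡ j)
  where

  -- Equal vectors mean that no cut of `K` separates the two vertices.
  open Image (image {A = Subset k} (≡-dec _≟ᵇ_)
                    (λ v → tabulate λ i → K i at v)) public

  -- Each `K i` is constant on the classes and so descends to a two-colouring of the nodes.
  bit : Fin k → Fin size → Bool
  bit i s = lookup (ι s) i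

  bit-π : ∀ i v → bit i (π v) ≡ K i at v
  bit-π i v = trans (cong (λ p → lookup p i) (ι-π v)) (lookup∘tabulate _ i)

  bit-ext : ∀ {s t} → (∀ i → bit i s ≡ bit i t) → s ≡ t
  bit-ext = ι-injective ∘ lookup-ext

  ends : Fin k → Pair size
  ends i = π (proj₁ (F i)) , π (proj₂ (F i))

  Joins : Fin k → Pair size → Set
  Joins i ab = SamePair ab (ends i)

  joins-flips : ∀ {i a b} → Joins i (a , b) → bit i a ≢ bit i b
  joins-flips {i} e = SamePair-≢ (bit i) e λ eq →
    separates⇒≢ (K i) (sep-self i)
      (trans (sym (bit-π i _)) (trans eq (bit-π i _)))

  -- `K i` separates no pair but `F i`, so the edge of `F j` changes no bit other than `j`. With
  -- `joins-flips` this makes the index of an edge unique.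
  flipped-joins : ∀ {i j a b} → Joins j (a , b) → bit i a ≢ bit i b → i ≡ j
  flipped-joins {i} {j} e ne = sep-unique (≢⇒separates (K i) λ eq →
    SamePair-≢ (bit i) (SamePair-sym e) ne (trans (bit-π i _) (trans eq (sym (bit-π i _)))))

  -- `D` bounds the cuts that a path may use: the full set serves connectedness, the complement of
  -- `i` serves the deletion of edge `i`.
  JoinedIn : Subset k → Fin size → Fin size → Set
  JoinedIn D a b = ∃[ i ] i ∈ D × Joins i (a , b)

  -- `u` and `v` lie on different sides, and so do the ends of `F i`; hence one comparison of bits
  -- matches them.
  orient : ∀ i {u v} → K i at u ≢ K i at v →
           ∃₂ λ p q → SamePair (p , q) (F i) × K i at p ≡ K i at u × K i at q ≡ K i at v
  orient i {u} {v} ne with F i | separates⇒≢ (K i) (sep-self i)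
  ... | x , y | x≢y with K i at x ≟ᵇ K i at u
  ...   | yes xu = x , y , inj₁ (refl , refl) , xu
                 , ≢-both⇒≡ (x≢y ∘ sym) (λ vx → ne (sym (trans vx xu)))
  ...   | no  x≢u = y , x , inj₂ (refl , refl)
                 , ≢-both⇒≡ (x≢y ∘ sym) (x≢u ∘ sym) , ≢-both⇒≡ x≢u (ne ∘ sym)

  -- Asking only that `D` contain the separating cuts lets both halves of the path recurse on the
  -- same `D - i`.
  joined-by-separators : ∀ D → Acc _⊂_ D → ∀ u v →
    (∀ j → K j at u ≢ K j at v → j ∈ D) → Star (JoinedIn D) (π u) (π v)
  joined-by-separators D (acc smaller) u v sep⊆D
    with any? (λ i → ¬? (K i at u ≟ᵇ K i at v))
  -- No cut separates `u` and `v`, so they share a node and the empty path suffices.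
  ... | no none = subst (Star (JoinedIn D) (π u)) (bit-ext same) ε
    where
    same : ∀ i → bit i (π u) ≡ bit i (π v)
    same i = trans (bit-π i u) (trans
      (decidable-stable (_ ≟ᵇ _) (λ ne → none (i , ne))) (sym (bit-π i v)))
  ... | yes (i , u≢v) with orient i u≢v
  ...   | p , q , pq , pu , qv =
    weaken (joined-by-separators (D - i) (smaller i-smaller) u p sep-up)
    ◅◅ (i , i∈D , joins) ◅
    weaken (joined-by-separators (D - i) (smaller i-smaller) q v sep-qv)
    where
    i∈D = sep⊆D i u≢v
    i-smaller = x∈p⇒p-x⊂p i∈D

    weaken : ∀ {s t} → Star (JoinedIn (D - i)) s t → Star (JoinedIn D) s t
    weaken = map λ { (j , j∈ , e) → j , p─q⊆p D _ j∈ , e }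

    joins : Joins i (π p , π q)
    joins = lift pq
      where
      lift : ∀ {a b c d} → SamePair (a , b) (c , d) → SamePair (π a , π b) (π c , π d)
      lift (inj₁ (refl , refl)) = inj₁ (refl , refl)
      lift (inj₂ (refl , refl)) = inj₂ (refl , refl)

    -- `p` and `q` are the ends of `F i`, which only `K i` separates.
    keeps : ∀ j → j ≢ i → K j at p ≡ K j at q
    keeps j j≢i = decidable-stable (_ ≟ᵇ _) λ ne → j≢i (flipped-joins joins
      λ eq → ne (trans (sym (bit-π j p)) (trans eq (bit-π j q))))

    -- `u` and `p` are on one side of `K i`, so `i` itself drops out of `D`.
    sep-up : ∀ j → K j at u ≢ K j at p → j ∈ D - i
    sep-up j ne = x∈p∧x≢y⇒x∈p-y
      (sep⊆D j (separation-propagates (K i) (K j) (noncrossing i j) pu qv u≢v (keeps j j≢i) ne)) j≢i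
      where
      j≢i : j ≢ i
      j≢i refl = ne (sym pu)

    -- The same argument read from `v` back to `q`.
    sep-qv : ∀ j → K j at q ≢ K j at v → j ∈ D - i
    sep-qv j ne = x∈p∧x≢y⇒x∈p-y
      (sep⊆D j (separation-propagates (K i) (K j) (noncrossing i j) qv pu (u≢v ∘ sym)
                  (sym (keeps j j≢i)) (ne ∘ sym) ∘ sym)) j≢i
      where
      j≢i : j ≢ i
      j≢i refl = ne qv

  joined : ∀ D s t → (∀ j → bit j s ≢ bit j t → j ∈ D) → Star (JoinedIn D) s t
  joined D s t sep⊆D with π-surj s | π-surj t
  ... | u , refl | v , refl = joined-by-separators D (⊂-wellFounded D) u v
    λ j ne → sep⊆D j λ eq → ne (trans (sym (bit-π j u)) (trans eq (bit-π j v)))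

  -- An adjacency proof carries the index of a cut, from which the cut and the weight of the edge
  -- are read later.
  graph : SimpleGraph size
  graph = record
    { _~_      = λ a b → ∃[ i ] Joins i (a , b)
    ; _~?_     = λ a b → any? λ i → samePair? (a , b) (ends i)
    ; ~-sym    = λ { {a} {b} (i , e) → i , SamePair-trans (SamePair-swap a b) e }
    ; ~-irrefl = λ { refl (i , e) → joins-flips e refl }
    }

  open SimpleGraph graph

  -- Only a step that joins the ends of `F i` can change bit `i`, and such a step is the deleted
  -- edge.
  without⇒same-bit : ∀ {i a b s t} → Joins i (a , b) → Without (a , b) s t → bit i s ≡ bit i t
  without⇒same-bit e ε = refl
  without⇒same-bit {i} e (((j , e′) , other) ◅ path) = trans
    (decidable-stable (_ ≟ᵇ _) λ ne → other (parallel (flipped-joins e′ ne)))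
    (without⇒same-bit e path)
    where
    parallel : i ≡ j → _
    parallel refl = SamePair-trans e′ (SamePair-sym e)

  -- `K i` does not separate `s` from `t`, so some path uses other indices only; a step of it along
  -- the deleted edge would have index `i`.
  same-bit⇒without : ∀ {i a b s t} → Joins i (a , b) → bit i s ≡ bit i t → Without (a , b) s t
  same-bit⇒without {i} {a} {b} {s} {t} e eq =
    map avoid (joined (∁ ⁅ i ⁆) s t
      λ j ne → x∉p⇒x∈∁p (x≢y⇒x∉⁅y⁆ λ { refl → ne eq }))
    where
    avoid : ∀ {c d} → JoinedIn (∁ ⁅ i ⁆) c d → c ~ d × ¬ SamePair (c , d) (a , b)
    avoid (j , j∈ , e′) = (j , e′) , λ same →
      x∉⁅y⁆⇒x≢y (x∈∁p⇒x∉p j∈) (sym (flipped-joins e′ (joins-flips (SamePair-trans same e))))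

  isTree : IsTree
  isTree = (λ s t → map (λ { (i , _ , e) → i , e }) (joined ⊤ s t λ _ _ → ∈⊤))
         -- A path around the deleted edge would preserve bit `i`, in which the ends of that edge
         -- differ.
         , bridges⇒acyclic graph λ { (i , e) path →
             joins-flips e (sym (without⇒same-bit e path)) }

-- Cuts, weights and cut pairs of the tree edges.

theorem1 : ∀ {c ℓ₁ ℓ₂ : Level} (C : OrderedAbelianGroup c ℓ₁ ℓ₂)
    (n : ℕ) (G : WeightedGraph C n) → PositiveWeights G →
    (k : ℕ) (K : Fin k → Cut n) (F : Fin k → Pair n) →
    Injective _≡_ _≈ᶜ_ K →
    (∀ i j → NonCrossing (K i) (K j)) →
    (∀ i → IsMinSeparating G (K i)) →
    Injective _≡_ SamePair F →
    (∀ i → IsCutPair G (K i) (F i)) →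
    (∀ i → ∃! _≡_ λ j → Separates (K i) (F j)) →
    ∃[ T ] IntermediateCutTree.Valid {G = G} T × IntermediateCutTree.RepresentsExactly T K
theorem1 C n G _ k K F _ noncrossing minSep _ cutPair unique =
  T , valid , (λ { (i , _) → i , inj₁ refl }) ,
  λ i → _ , _ , (i , inj₁ (refl , refl)) , inj₁ refl
  where
  sep-self : ∀ i → Separates (K i) (F i)
  sep-self i = proj₁ (cutPair i)

  sep-unique : ∀ {i j} → Separates (K i) (F j) → i ≡ j
  sep-unique {i} sep with unique i
  ... | _ , _ , only = trans (sym (only (sep-self i))) (only sep)

  open Tree K F noncrossing sep-self sep-unique
  open OrderedAbelianGroup C using () renaming (refl to ≈-refl)
  open SimpleGraph graph using (_~_; Without)

  -- Both adjacency proofs carry the same index, hence the same cut.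
  weight-sym : ∀ {u v} (e : u ~ v) (e′ : v ~ u) →
               OrderedAbelianGroup._≈_ C (cost G (K (proj₁ e))) (cost G (K (proj₁ e′)))
  weight-sym (i , e) (j , e′) with flipped-joins e′ (joins-flips e ∘ sym)
  ... | refl = ≈-refl

  induced : ∀ {a b} (e : a ~ b) → ∃[ X ] IsSide (K (proj₁ e)) X
    × (∀ v → v ∈ X   ⇔ (∃[ s ] Without (a , b) a s × v ∈ fiber π s))
    × (∀ v → v ∈ ∁ X ⇔ (∃[ s ] Without (a , b) b s × v ∈ fiber π s))
  -- `X` is the side that holds node `a`; the bit of `a` selects it, as the cut may be stored
  -- through either side.
  induced {a} {b} (i , e) = sideOf (K i) (bit i a) , sideOf-isSide (K i) (bit i a)
    , (λ v → let open Equivalence (∈-sideOf (K i) (bit i a) v) in mk⇔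
        (λ v∈ → π v , same-bit⇒without e (sym (trans (bit-π i v) (to v∈))) , ∈-fiber⁺ π refl)
        (λ { (s , path , v∈) → from (same-at v∈ path) }))
    , (λ v → let open Equivalence (∈-∁sideOf (K i) (bit i a) v) in mk⇔
        (λ v∈ → π v , same-bit⇒without e (sym (trans (bit-π i v)
                        (≢-both⇒≡ (to v∈) (joins-flips e ∘ sym)))) , ∈-fiber⁺ π refl)
        (λ { (s , path , v∈) → from λ eq →
               joins-flips e (trans (sym eq) (same-at v∈ path)) }))
    where
    same-at : ∀ {s t v} → v ∈ fiber π s → Without (a , b) t s → K i at v ≡ bit i t
    same-at {v = v} v∈ path = trans (sym (bit-π i v))
      (trans (cong (bit i) (∈-fiber⁻ π v∈)) (sym (without⇒same-bit e path)))

  T : IntermediateCutTree G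
  T = record
    { size           = size
    ; tree           = record
      { graph      = graph
      ; weight     = λ e → cost G (K (proj₁ e))
      ; weight-sym = weight-sym
      }
    ; isTree         = isTree
    ; node           = fiber π
    ; node-nonempty  = λ s → let v , eq = π-surj s in v , ∈-fiber⁺ π eq
    ; node-partition = λ v → π v , ∈-fiber⁺ π refl , ∈-fiber⁻ π
    ; cut            = λ e → K (proj₁ e)
    ; cut-induced    = induced
    ; weight-cost    = λ _ → ≈-refl
    ; cut-separating = λ e → minSep (proj₁ e)
    }

  valid : IntermediateCutTree.Valid T
  -- The edge was drawn between the classes of the ends of `F i`, so `F i` is the required cut pair;
  -- for the reversed edge its ends are swapped.
  valid (i , inj₁ (refl , refl)) = _ , _ , ∈-fiber⁺ π refl , ∈-fiber⁺ π refl , cutPair i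
  valid (i , inj₂ (refl , refl)) = _ , _ , ∈-fiber⁺ π refl , ∈-fiber⁺ π refl ,
    Separates-swap (K i) (sep-self i) ,
    λ B sep → proj₂ (cutPair i) B (Separates-swap B sep)
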